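{- Let $n \ge 1$ and $1 \le m \le n$ be integers, and put $s_k = 8(n-k)$ and $M_k = 2^{k-1}(8n+16) - 16$ for $k \ge 1$. Consider Boolean variables $x_{(k,i)} \in \{0,1\}$ for $k \in \{1,\dots,m\}$ and $i \in \{1,2,3,4,5,6,A,B\}$ ($8m$ variables), and write an assignment as a bit string listing the variables in the order $(m,1),\dots,(m,6),(m,A),(m,B),(m-1,1),\dots,(m-1,B),\dots,(1,1),\dots,(1,B)$. For each $k$ define (writing $x_i$ for $x_{(k,i)}$) $$\begin{aligned} g_k(x) ={}& -(2M_k+13)x_1 - (M_k+5)x_2 - (M_k+3)x_3 - (M_k+s_k+7)x_4 - x_5 - (M_k+1)x_6 - (s_k+5)x_A - (s_k+3)x_B \\ &+ (M_k+6)x_1x_2 + (M_k+4)x_2x_3 + (M_k+2)x_3x_6 + (M_k+6)x_1x_4 + (M_k+4)x_4x_5 - (M_k+2)x_5x_6 \\ &+ (s_k+4)x_Ax_B - 2x_1x_B + (s_k+4)x_2x_B + (s_k+2)x_4x_A + (s_k+2)x_4x_B \\ &- (s_k+4)x_2x_Ax_B - (s_k+2)x_4x_Ax_B, \end{aligned}$$ and for $P \in \{0,1\}$ define the fitness function $$f^{P}(x) = \sum_{k=1}^{m} g_k(x) + \sum_{k=2}^{m} M_k\, x_{(k,6)}x_{(k-1,1)} + \sum_{k=1}^{m-1} s_k\, x_{(k,B)}x_{(k+1,A)} + 8n\, x_{(1,6)}x_{(1,A)} + P\,(2M_m+16)\,x_{(m,1)}.$$ Let $a = 0^{8m}$ and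 $b = 111110\,01\,0^{8(m-1)}$. Then: (1) in the fitness landscape of $f^{1}$ there is exactly one ascent starting from $a$, and it ends at the local peak $b$; (2) in the fitness landscape of $f^{0}$ there is exactly one ascent starting from $b$, and it ends at the local peak $a$. Both ascents have length $T_m = 10(2^m - 1)$.
   Context: Two assignments in $\{0,1\}^{8m}$ are adjacent if they differ in exactly one variable. For a fitness function $f$, an assignment $x^*$ is a local peak if $f(y) \le f(x^*)$ for every assignment $y$ adjacent to $x^*$. An ascent from $x^0$ is a sequence $x^0, x^1, \dots, x^T$ of assignments such that $x^{t}$ and $x^{t+1}$ are adjacent and $f(x^{t+1}) > f(x^t)$ for each $t$, and $x^T$ is a local peak; its length is $T$. The fitness landscape of $f$ is $f$ together with this adjacency structure. -}

module Defs where

open import Data.Bool.Base using (Bool; true; false)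
open import Data.Fin.Base using (Fin; zero; suc; toℕ; inject₁; combine; opposite)
open import Data.Fin.Patterns using (0F; 1F; 2F; 3F; 4F; 5F; 6F; 7F)
open import Data.Integer.Base using (ℤ; +_; -_; _+_; _-_; _*_; _≤_; _<_)
open import Data.Integer.Properties using (+-0-commutativeMonoid)
import Data.Nat.Base as ℕ
open ℕ using (ℕ; suc; NonZero; _∸_; _^_)
open import Data.Product.Base using (Σ; _×_; _,_; proj₁)
open import Data.Product using (∃!)
open import Data.Vec.Base using (Vec; []; _∷_; _++_; head; last; lookup; replicate)
open import Relation.Binary.PropositionalEquality using (_≡_; _≢_)

open import Algebra.Properties.CommutativeMonoid.Sum +-0-commutativeMonoid using (sum-syntax)

-- The bit string lists the blocks in the order m, m-1, …, 1, each block in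
-- the order 1, …, 6, A, B.
Assignment : ℕ → Set
Assignment m = Vec Bool (m ℕ.* 8)

pattern i₁ = 0F
pattern i₂ = 1F
pattern i₃ = 2F
pattern i₄ = 3F
pattern i₅ = 4F
pattern i₆ = 5F
pattern iA = 6F
pattern iB = 7F

⟦_⟧ : Bool → ℤ
⟦ false ⟧ = + 0
⟦ true  ⟧ = + 1

-- j : Fin m stands for the block number k = level j ∈ {1, …, m}.
level : ∀ {m} → Fin m → ℕ
level j = suc (toℕ j)

-- Block k sits at block position m - k of the bit string, whence opposite.
var : ∀ {m} → Assignment m → Fin m → Fin 8 → ℤ
var x j i = ⟦ lookup x (combine (opposite j) i) ⟧

s : (n k : ℕ) → ℤ
s n k = + 8 * (+ n - + k)

M : (n k : ℕ) → ℤ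
M n k = + (2 ^ (k ∸ 1)) * (+ 8 * + n + + 16) - + 16

-- y i is the value of x_(k,i).
g : (n k : ℕ) → (Fin 8 → ℤ) → ℤ
g n k y =
    - ((+ 2 * Mₖ + + 13) * x₁)
  - (Mₖ + + 5) * x₂
  - (Mₖ + + 3) * x₃
  - (Mₖ + sₖ + + 7) * x₄
  - x₅
  - (Mₖ + + 1) * x₆
  - (sₖ + + 5) * xA
  - (sₖ + + 3) * xB
  + (Mₖ + + 6) * x₁ * x₂
  + (Mₖ + + 4) * x₂ * x₃
  + (Mₖ + + 2) * x₃ * x₆
  + (Mₖ + + 6) * x₁ * x₄
  + (Mₖ + + 4) * x₄ * x₅
  - (Mₖ + + 2) * x₅ * x₆
  + (sₖ + + 4) * xA * xB
  - + 2 * x₁ * xB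
  + (sₖ + + 4) * x₂ * xB
  + (sₖ + + 2) * x₄ * xA
  + (sₖ + + 2) * x₄ * xB
  - (sₖ + + 4) * x₂ * xA * xB
  - (sₖ + + 2) * x₄ * xA * xB
  where
  Mₖ = M n k
  sₖ = s n k
  x₁ = y i₁
  x₂ = y i₂
  x₃ = y i₃
  x₄ = y i₄
  x₅ = y i₅
  x₆ = y i₆
  xA = y iA
  xB = y iB

-- With m = suc p, the index j : Fin p of a coupling term gives the consecutive
-- blocks inject₁ j (number level j) and suc j (number level j + 1).
-- In the second sum k = level (suc j); in the third k = level (inject₁ j).
fitness : (n m : ℕ) .{{_ : NonZero m}} → (P : Bool) → Assignment m → ℤ
fitness n (suc p) P x =
    (∑[ j < suc p ] (g n (level j) (var x j)))
  + (∑[ j < p ] (M n (level (suc j)) * var x (suc j) i₆ * var x (inject₁ j) i₁))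
  + (∑[ j < p ] (s n (level (inject₁ j)) * var x (inject₁ j) iB * var x (suc j) iA))
  + + 8 * + n * var x first i₆ * var x first iA
  + ⟦ P ⟧ * (+ 2 * M n (suc p) + + 16) * var x top i₁
  where
  first top : Fin (suc p)
  first = zero
  top   = opposite zero

a : (m : ℕ) → Assignment m
a m = replicate (m ℕ.* 8) false

b : (m : ℕ) .{{_ : NonZero m}} → Assignment m
b (suc p) =
  (true ∷ true ∷ true ∷ true ∷ true ∷ false ∷ false ∷ true ∷ [])
  ++ replicate (p ℕ.* 8) false

module Landscape {N : ℕ} (f : Vec Bool N → ℤ) where

  Adjacent : Vec Bool N → Vec Bool N → Set
  Adjacent x y = ∃! _≡_ λ i → lookup x i ≢ lookup y i

  LocalPeak : Vec Bool N → Set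
  LocalPeak x = ∀ y → Adjacent x y → f y ≤ f x

  -- (T , x⁰ ∷ x¹ ∷ … ∷ x^T ∷ [])
  Sequence : Set
  Sequence = Σ ℕ λ T → Vec (Vec Bool N) (suc T)

  length : Sequence → ℕ
  length = proj₁

  end : Sequence → Vec Bool N
  end (_ , xs) = last xs

  IsAscentFrom : Vec Bool N → Sequence → Set
  IsAscentFrom x⁰ (T , xs) =
      head xs ≡ x⁰
    × (∀ (t : Fin T) → Adjacent (lookup xs (inject₁ t)) (lookup xs (suc t))
                     × f (lookup xs (inject₁ t)) < f (lookup xs (suc t)))
    × LocalPeak (last xs)

  -- The uniqueness is that of the sequence of assignments.
  ExactlyOneAscent : (from to : Vec Bool N) (T : ℕ) → Set
  ExactlyOneAscent from to T =
    Σ (∃! _≡_ (IsAscentFrom from)) λ (σ , _) → end σ ≡ to × length σ ≡ T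

{-# OPTIONS --safe #-}
module Submission where

-- The blocks 1, …, k only see the rest of the landscape through u = x_(k+1,6) and
-- w = x_(k+1,A), where P plays the role of u for k = m because M_(m+1) = 2 M_m + 16.  By
-- induction on k, for (u,w) = (1,0) they climb from 0…0 to 11111001 0…0 along a unique
-- path, and for u = 0 they climb back.  In either direction block k+1 makes four forced
-- moves, waits while the blocks below (now driven by x_6 = 1) climb, makes four further
-- moves, waits while they climb back (now x_6 = 0), and makes two last moves; hence
-- T_(k+1) = 2 T_k + 10.  While block k+1 waits, only the value of x_(k,B) could release it,
-- and this bit is flipped by the very last move of the blocks below.
--
-- With s_k = σ and M_k = 8 + δ + σ the gain of each relevant move is affine in δ, σ ≥ 0 and
-- all its coefficients have the same sign, so that the moves are checked by computation.

open import Defs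
open import Data.Bool.Base using (Bool; true; false; not)
import Data.Bool.Properties as Bool
open import Data.Fin.Base using (Fin; zero; suc; inject₁; fromℕ; opposite; combine; _↑ˡ_; _↑ʳ_; splitAt; join)
import Data.Fin.Properties as Fin
open import Data.Integer.Base as ℤ using (ℤ; +_; -_)
import Data.Integer.Properties as ℤ
open import Data.Integer.Solver using (module +-*-Solver)
open +-*-Solver using (solve; _:=_; _:+_; _:*_; _:-_; :-_; con)
open import Data.List.Base as List using (List; []; _∷_)
import Data.Nat.Base as ℕ
open import Data.Nat.Base using (ℕ; NonZero; _≤_; _*_; _^_; _∸_; zero; suc)
import Data.Nat.Properties as ℕ
open import Data.Nat.Tactic.RingSolver using (solve-∀)
open import Data.Product.Base using (∃; _×_; _,_; proj₁; proj₂)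
open import Data.Sum.Base using (inj₁; inj₂)
open import Data.Unit.Base using (⊤; tt)
open import Data.Vec.Base using (Vec; []; _∷_; _++_; lookup; updateAt; last)
open import Data.Vec.Properties using (lookup∘updateAt; lookup∘updateAt′; tabulate∘lookup; tabulate-cong)
open import Function.Base using (_∘_)
open import Relation.Binary.PropositionalEquality using (_≡_; _≢_; refl; sym; trans; cong; cong₂; subst; subst₂; module ≡-Reasoning)
open import Relation.Nullary.Decidable using (Dec; yes; no; _×-dec_; _→-dec_; ¬?; True; toWitness; decidable-stable)
open import Relation.Nullary.Negation using (contradiction)
open import Algebra.Properties.CommutativeMonoid.Sum ℤ.+-0-commutativeMonoid using (sum-syntax; sum-init-last; sum-cong-≗)

private
  variable
    N : ℕ

flip : Vec Bool N → Fin N → Vec Bool N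
flip x i = updateAt x i not

flip-adjacent : (f : Vec Bool N → ℤ) (x : Vec Bool N) (i : Fin N) → Landscape.Adjacent f x (flip x i)
flip-adjacent f x i = i , differ , unique
  where
  differ : lookup x i ≢ lookup (flip x i) i
  differ eq = Bool.not-¬ refl (trans eq (lookup∘updateAt i x))

  unique : ∀ {j} → lookup x j ≢ lookup (flip x i) j → i ≡ j
  unique {j} x≢ with i Fin.≟ j
  ... | yes i≡j = i≡j
  ... | no  i≢j = contradiction (sym (lookup∘updateAt′ j i (i≢j ∘ sym) x)) x≢

adjacent⇒flip : (f : Vec Bool N → ℤ) (x y : Vec Bool N) → Landscape.Adjacent f x y → ∃ λ i → y ≡ flip x i
adjacent⇒flip f x y (i , differ , unique) =
  i , trans (sym (tabulate∘lookup y)) (trans (tabulate-cong agree) (tabulate∘lookup (flip x i)))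
  where
  agree : ∀ j → lookup y j ≡ lookup (flip x i) j
  agree j with i Fin.≟ j
  ... | yes refl = trans (Bool.¬-not (differ ∘ sym)) (sym (lookup∘updateAt i x))
  ... | no  i≢j  = trans (sym (decidable-stable (lookup x j Bool.≟ lookup y j) (i≢j ∘ unique)))
                         (sym (lookup∘updateAt′ j i (i≢j ∘ sym) x))

Peak : (Vec Bool N → ℤ) → Vec Bool N → Set
Peak f x = ∀ i → f (flip x i) ℤ.≤ f x

Forced : (Vec Bool N → ℤ) → Vec Bool N → Fin N → Set
Forced f x i = f x ℤ.< f (flip x i) × (∀ j → j ≢ i → f (flip x j) ℤ.≤ f x)

infixr 5 _++ᴿ_

-- Q is required of every state but the last.
data Run (f : Vec Bool N → ℤ) (Q : Vec Bool N → Set) : (x y : Vec Bool N) → ℕ → Set where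
  done : ∀ {x} → Run f Q x x 0
  step : ∀ {x y z i T} → Q x → Forced f x i → flip x i ≡ y → Run f Q y z T → Run f Q x z (suc T)

_++ᴿ_ : ∀ {f Q} {x y z : Vec Bool N} {S T} → Run f Q x y S → Run f Q y z T → Run f Q x z (S ℕ.+ T)
done             ++ᴿ r′ = r′
step q best eq r ++ᴿ r′ = step q best eq (r ++ᴿ r′)

Peak-cong : ∀ {f h : Vec Bool N → ℤ} → (∀ x → f x ≡ h x) → ∀ {x} → Peak f x → Peak h x
Peak-cong f≗h {x} peak i = subst₂ ℤ._≤_ (f≗h (flip x i)) (f≗h x) (peak i)

Run-cong : ∀ {f h : Vec Bool N → ℤ} {Q} → (∀ x → f x ≡ h x) → ∀ {x y T} → Run f Q x y T → Run h Q x y T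
Run-cong f≗h done = done
Run-cong f≗h (step {x} {i = i} q (up , rest) eq r) =
  step q (subst₂ ℤ._<_ (f≗h x) (f≗h (flip x i)) up , λ j j≢i → subst₂ ℤ._≤_ (f≗h (flip x j)) (f≗h x) (rest j j≢i))
    eq (Run-cong f≗h r)

module _ {f : Vec Bool N → ℤ} {Q : Vec Bool N → Set} where
  open Landscape f

  trail : ∀ {x y T} → Run f Q x y T → Vec (Vec Bool N) T
  trail done                   = []
  trail (step {y = y} _ _ _ r) = y ∷ trail r

  last-trail : ∀ {x y T} (r : Run f Q x y T) → last (x ∷ trail r) ≡ y
  last-trail done           = refl
  last-trail (step _ _ _ r) = last-trail r

  trail-ascends : ∀ {x y T} (r : Run f Q x y T) (t : Fin T) → let xs = x ∷ trail r in
    Adjacent (lookup xs (inject₁ t)) (lookup xs (suc t)) × f (lookup xs (inject₁ t)) ℤ.< f (lookup xs (suc t))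
  trail-ascends (step {x} {i = i} _ (up , _) refl _) zero = flip-adjacent f x i , up
  trail-ascends (step _ _ _ r) (suc t) = trail-ascends r t

  Peak⇒LocalPeak : ∀ {x} → Peak f x → LocalPeak x
  Peak⇒LocalPeak {x} peak y adj with i , refl ← adjacent⇒flip f x y adj = peak i

  forced-move : ∀ {x i y} → Forced f x i → Adjacent x y → f x ℤ.< f y → y ≡ flip x i
  forced-move {x} {i} {y} (_ , others) adj x<y with adjacent⇒flip f x y adj
  ... | j , refl with j Fin.≟ i
  ...   | yes refl = refl
  ...   | no  j≢i  = contradiction x<y (ℤ.≤⇒≯ (others j j≢i))

  trail-unique : ∀ {x y T} (r : Run f Q x y T) → Peak f y → ∀ {T′} (xs : Vec (Vec Bool N) T′) →
    IsAscentFrom x (T′ , x ∷ xs) → _≡_ {A = Sequence} (T , x ∷ trail r) (T′ , x ∷ xs)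
  trail-unique done peak [] _ = refl
  trail-unique {x} done peak (z ∷ xs) (_ , steps , _) with steps zero
  ... | adj , x<z = contradiction x<z (ℤ.≤⇒≯ (Peak⇒LocalPeak peak z adj))
  trail-unique (step {x} {i = i} _ (up , _) _ _) peak [] (_ , _ , top) =
    contradiction up (ℤ.≤⇒≯ (top (flip x i) (flip-adjacent f x i)))
  trail-unique (step {x} _ best refl r) peak (z ∷ xs) (_ , steps , top)
    with refl ← forced-move best (proj₁ (steps zero)) (proj₂ (steps zero)) =
    cong (λ (T , ys) → suc T , x ∷ ys) (trail-unique r peak xs (refl , steps ∘ suc , top))

  run⇒exactlyOneAscent : ∀ {x y T} → Run f Q x y T → Peak f y → ExactlyOneAscent x y T
  run⇒exactlyOneAscent {x} {y} {T} r peak =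
    ((T , x ∷ trail r) , ascent , λ { {T′ , x′ ∷ xs} p@(refl , _) → trail-unique r peak xs p }) , last-trail r , refl
    where
    ascent : IsAscentFrom x (T , x ∷ trail r)
    ascent = refl , trail-ascends r , subst LocalPeak (sym (last-trail r)) (Peak⇒LocalPeak peak)

Block : Set
Block = Vec Bool 8

bits : Block → Fin 8 → ℤ
bits y i = ⟦ lookup y i ⟧

-- What block k+1 sees of the blocks 1, …, k; bottom is the case k = 0.
data Output : Set where
  bottom : Output
  output : (x₁ xB : Bool) → Output

out : ∀ k → Assignment k → Output
out zero    _ = bottom
out (suc k) (x₁ ∷ _ ∷ _ ∷ _ ∷ _ ∷ _ ∷ _ ∷ xB ∷ _) = output x₁ xB

-- The bottom clause is only meant for k = 0, where it gives the term 8n x_(1,6) x_(1,A)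
-- because M_1 = 8n.
couple : (n k : ℕ) → Output → (u w : Bool) → ℤ
couple n k bottom         u w = M n (suc k) ℤ.* ⟦ u ⟧ ℤ.* ⟦ w ⟧
couple n k (output x₁ xB) u w = M n (suc k) ℤ.* ⟦ u ⟧ ℤ.* ⟦ x₁ ⟧ ℤ.+ s n k ℤ.* ⟦ xB ⟧ ℤ.* ⟦ w ⟧

stack : (n k : ℕ) → Assignment k → ℤ
stack n zero    _ = + 0
stack n (suc k) (x₁ ∷ x₂ ∷ x₃ ∷ x₄ ∷ x₅ ∷ x₆ ∷ xA ∷ xB ∷ r) =
  g n (suc k) (bits (x₁ ∷ x₂ ∷ x₃ ∷ x₄ ∷ x₅ ∷ x₆ ∷ xA ∷ xB ∷ []))
  ℤ.+ couple n k (out k r) x₆ xA ℤ.+ stack n k r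

driven : (n k : ℕ) (u w : Bool) → Assignment k → ℤ
driven n k u w x = stack n k x ℤ.+ couple n k (out k x) u w

own : (n k : ℕ) (u w : Bool) → Block → ℤ
own n k u w y = g n (suc k) (bits y) ℤ.+ couple n (suc k) (output (lookup y i₁) (lookup y iB)) u w

energy : (n k : ℕ) → Output → (u w : Bool) → Block → ℤ
energy n k ω u w y = own n k u w y ℤ.+ couple n k ω (lookup y i₆) (lookup y iA)

driven-energy : ∀ n k u w y r → driven n (suc k) u w (y ++ r) ≡ energy n k (out k r) u w y ℤ.+ stack n k r
driven-energy n k u w (x₁ ∷ x₂ ∷ x₃ ∷ x₄ ∷ x₅ ∷ x₆ ∷ xA ∷ xB ∷ []) r =
  solve 4 (λ G C S D → (G :+ C :+ S) :+ D := ((G :+ D) :+ C) :+ S) refl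
    (g n (suc k) (bits (x₁ ∷ x₂ ∷ x₃ ∷ x₄ ∷ x₅ ∷ x₆ ∷ xA ∷ xB ∷ [])))
    (couple n k (out k r) x₆ xA) (stack n k r) (couple n (suc k) (output x₁ xB) u w)

driven-rest : ∀ n k u w y r →
  driven n (suc k) u w (y ++ r) ≡ own n k u w y ℤ.+ driven n k (lookup y i₆) (lookup y iA) r
driven-rest n k u w y r = trans (driven-energy n k u w y r)
  (solve 3 (λ G C S → (G :+ C) :+ S := G :+ (S :+ C)) refl
    (own n k u w y) (couple n k (out k r) (lookup y i₆) (lookup y iA)) (stack n k r))

flip-++ˡ : ∀ {m n} (y : Vec Bool m) (r : Vec Bool n) i → flip (y ++ r) (i ↑ˡ n) ≡ flip y i ++ r
flip-++ˡ (x ∷ y) r zero    = refl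
flip-++ˡ (x ∷ y) r (suc i) = cong (x ∷_) (flip-++ˡ y r i)

flip-++ʳ : ∀ {m n} (y : Vec Bool m) (r : Vec Bool n) j → flip (y ++ r) (m ↑ʳ j) ≡ y ++ flip r j
flip-++ʳ []      r j = refl
flip-++ʳ (x ∷ y) r j = cong (x ∷_) (flip-++ʳ y r j)

join-elim : ∀ m {n} (P : Fin (m ℕ.+ n) → Set) → (∀ i → P (i ↑ˡ n)) → (∀ j → P (m ↑ʳ j)) → ∀ p → P p
join-elim m {n} P left right p = subst P (Fin.join-splitAt m n p) (go (splitAt m p))
  where
  go : ∀ q → P (join m n q)
  go (inj₁ i) = left i
  go (inj₂ j) = right j

module _ (n k : ℕ) (u w : Bool) (y : Block) (r : Assignment k) where
  private
    f = driven n (suc k) u w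
    e = energy n k (out k r) u w
    h = driven n k (lookup y i₆) (lookup y iA)

    f-block : ∀ i → f (flip (y ++ r) (i ↑ˡ _)) ≡ e (flip y i) ℤ.+ stack n k r
    f-block i = trans (cong f (flip-++ˡ y r i)) (driven-energy n k u w (flip y i) r)

    f-rest : ∀ j → f (flip (y ++ r) (8 ↑ʳ j)) ≡ own n k u w y ℤ.+ h (flip r j)
    f-rest j = trans (cong f (flip-++ʳ y r j)) (driven-rest n k u w y (flip r j))

    block-≤ : ∀ {i} → e (flip y i) ℤ.≤ e y → f (flip (y ++ r) (i ↑ˡ _)) ℤ.≤ f (y ++ r)
    block-≤ {i} le = subst₂ ℤ._≤_ (sym (f-block i)) (sym (driven-energy n k u w y r)) (ℤ.+-monoˡ-≤ (stack n k r) le)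

    rest-≤ : ∀ {j} → h (flip r j) ℤ.≤ h r → f (flip (y ++ r) (8 ↑ʳ j)) ℤ.≤ f (y ++ r)
    rest-≤ {j} le = subst₂ ℤ._≤_ (sym (f-rest j)) (sym (driven-rest n k u w y r)) (ℤ.+-monoʳ-≤ (own n k u w y) le)

  peak-++ : Peak e y → Peak h r → Peak f (y ++ r)
  peak-++ py pr = join-elim 8 _ (λ i → block-≤ (py i)) (λ j → rest-≤ (pr j))

  forced-++ˡ : ∀ {i} → Forced e y i → Peak h r → Forced f (y ++ r) (i ↑ˡ _)
  forced-++ˡ {i} (up , others) pr =
    subst₂ ℤ._<_ (sym (driven-energy n k u w y r)) (sym (f-block i)) (ℤ.+-monoˡ-< (stack n k r) up) ,
    join-elim 8 _ (λ j ne → block-≤ (others j (ne ∘ cong (_↑ˡ _)))) (λ j _ → rest-≤ (pr j))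

  forced-++ʳ : ∀ {j} → Peak e y → Forced h r j → Forced f (y ++ r) (8 ↑ʳ j)
  forced-++ʳ {j} py (up , others) =
    subst₂ ℤ._<_ (sym (driven-rest n k u w y r)) (sym (f-rest j)) (ℤ.+-monoʳ-< (own n k u w y) up) ,
    join-elim 8 _ (λ i _ → block-≤ (py i)) (λ i ne → rest-≤ (others i (ne ∘ cong (8 ↑ʳ_))))

module Affine (δ σ : ℕ) where

  record Aff (z : ℤ) : Set where
    constructor aff
    field
      c α β  : ℤ
      value  : z ≡ c ℤ.+ α ℤ.* + δ ℤ.+ β ℤ.* + σ

  open Aff

  infixl 6 _⊕_ _⊖_
  infixl 7 _⊛_
  infix  8 ⊝_
  infix  4 _≼_ _≺_ _≼?_ _≺?_

  cast : ∀ {x y} → x ≡ y → Aff x → Aff y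
  cast x≡y (aff c α β p) = aff c α β (trans (sym x≡y) p)

  δ̂ : Aff (+ δ)
  δ̂ = aff (+ 0) (+ 1) (+ 0) (solve 2 (λ d t → d := con (+ 0) :+ con (+ 1) :* d :+ con (+ 0) :* t) refl (+ δ) (+ σ))

  σ̂ : Aff (+ σ)
  σ̂ = aff (+ 0) (+ 0) (+ 1) (solve 2 (λ d t → t := con (+ 0) :+ con (+ 0) :* d :+ con (+ 1) :* t) refl (+ δ) (+ σ))

  const : ∀ z → Aff z
  const z = aff z (+ 0) (+ 0) (solve 3 (λ z d t → z := z :+ con (+ 0) :* d :+ con (+ 0) :* t) refl z (+ δ) (+ σ))

  _⊕_ : ∀ {x y} → Aff x → Aff y → Aff (x ℤ.+ y)
  aff c α β p ⊕ aff c′ α′ β′ q = aff (c ℤ.+ c′) (α ℤ.+ α′) (β ℤ.+ β′) (trans (cong₂ ℤ._+_ p q)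
    (solve 8 (λ c a b c′ a′ b′ d t → (c :+ a :* d :+ b :* t) :+ (c′ :+ a′ :* d :+ b′ :* t)
      := (c :+ c′) :+ (a :+ a′) :* d :+ (b :+ b′) :* t) refl c α β c′ α′ β′ (+ δ) (+ σ)))

  ⊝_ : ∀ {x} → Aff x → Aff (- x)
  ⊝ aff c α β p = aff (- c) (- α) (- β) (trans (cong -_ p)
    (solve 5 (λ c a b d t → :- (c :+ a :* d :+ b :* t) := (:- c) :+ (:- a) :* d :+ (:- b) :* t) refl c α β (+ δ) (+ σ)))

  _⊖_ : ∀ {x y} → Aff x → Aff y → Aff (x ℤ.- y)
  a ⊖ b = a ⊕ (⊝ b)

  _⊛_ : ∀ {x} → Aff x → ∀ b → Aff (x ℤ.* ⟦ b ⟧)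
  _⊛_ {x} a false = cast (sym (ℤ.*-zeroʳ x)) (const (+ 0))
  _⊛_ {x} a true  = cast (sym (ℤ.*-identityʳ x)) a

  double : ∀ {x} → Aff x → Aff (+ 2 ℤ.* x)
  double {x} a = cast (solve 1 (λ x → x :+ x := con (+ 2) :* x) refl x) (a ⊕ a)

  _≼_ _≺_ : ∀ {x y} → Aff x → Aff y → Set
  a ≼ b = c a ℤ.≤ c b × α a ℤ.≤ α b × β a ℤ.≤ β b
  a ≺ b = c a ℤ.< c b × α a ℤ.≤ α b × β a ℤ.≤ β b

  _≼?_ : ∀ {x y} (a : Aff x) (b : Aff y) → Dec (a ≼ b)
  a ≼? b = (c a ℤ.≤? c b) ×-dec (α a ℤ.≤? α b) ×-dec (β a ℤ.≤? β b)

  _≺?_ : ∀ {x y} (a : Aff x) (b : Aff y) → Dec (a ≺ b)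
  a ≺? b = (c a ℤ.<? c b) ×-dec (α a ℤ.≤? α b) ×-dec (β a ℤ.≤? β b)

  ≼⇒≤ : ∀ {x y} {a : Aff x} {b : Aff y} → a ≼ b → x ℤ.≤ y
  ≼⇒≤ {a = a} {b} (c≤ , α≤ , β≤) = subst₂ ℤ._≤_ (sym (value a)) (sym (value b))
    (ℤ.+-mono-≤ (ℤ.+-mono-≤ c≤ (ℤ.*-monoʳ-≤-nonNeg (+ δ) α≤)) (ℤ.*-monoʳ-≤-nonNeg (+ σ) β≤))

  ≺⇒< : ∀ {x y} {a : Aff x} {b : Aff y} → a ≺ b → x ℤ.< y
  ≺⇒< {a = a} {b} (c< , α≤ , β≤) = subst₂ ℤ._<_ (sym (value a)) (sym (value b))
    (ℤ.+-mono-<-≤ (ℤ.+-mono-<-≤ c< (ℤ.*-monoʳ-≤-nonNeg (+ δ) α≤)) (ℤ.*-monoʳ-≤-nonNeg (+ σ) β≤))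

settled : Bool → Block
settled c = c ∷ c ∷ c ∷ c ∷ c ∷ false ∷ false ∷ c ∷ []

-- The inputs u = c, w under which the blocks below run from stable (not c) to stable c.
data Drive : (c w : Bool) → Set where
  up   : Drive true false
  down : ∀ {w} → Drive false w

moves₁ moves₂ : Bool → List (Fin 8)
moves₁ true  = i₁ ∷ i₂ ∷ i₃ ∷ i₆ ∷ []
moves₁ false = i₁ ∷ i₄ ∷ i₅ ∷ i₆ ∷ []
moves₂ true  = iA ∷ i₄ ∷ i₅ ∷ i₆ ∷ []
moves₂ false = iA ∷ i₂ ∷ i₃ ∷ i₆ ∷ []

moves₃ : List (Fin 8)
moves₃ = iA ∷ iB ∷ []

waiting₁ waiting₂ : Bool → Block
waiting₁ c = List.foldl flip (settled (not c)) (moves₁ c)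
waiting₂ c = List.foldl flip (waiting₁ c) (moves₂ c)

interface : ℕ → Bool → Output
interface zero    c = bottom
interface (suc _) c = output c c

M-step : ∀ n k → M n (suc (suc k)) ≡ + 2 ℤ.* M n (suc k) ℤ.+ + 16
M-step n k = trans
  (cong (λ p → p ℤ.* (+ 8 ℤ.* + n ℤ.+ + 16) ℤ.- + 16) (ℤ.pos-* 2 (2 ^ k)))
  (solve 2 (λ p n → con (+ 2) :* p :* (con (+ 8) :* n :+ con (+ 16)) :- con (+ 16)
                  := con (+ 2) :* (p :* (con (+ 8) :* n :+ con (+ 16)) :- con (+ 16)) :+ con (+ 16))
    refl (+ (2 ^ k)) (+ n))

s-step : ∀ n k → s n k ≡ s n (suc k) ℤ.+ + 8
s-step n k = solve 2 (λ n k → con (+ 8) :* (n :- k) := con (+ 8) :* (n :- (con (+ 1) :+ k)) :+ con (+ 8)) refl (+ n) (+ k)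

parameters : ∀ n k → suc k ≤ n → ∃ λ δ → ∃ λ σ → s n (suc k) ≡ + σ × M n (suc k) ≡ + 8 ℤ.+ + δ ℤ.+ + σ
parameters n k k<n with d , refl ← ℕ.m≤n⇒∃[o]m+o≡n k<n | e , 1+e≡2^k ← ℕ.m≤n⇒∃[o]m+o≡n (ℕ.m^n>0 2 k) =
  8 * k ℕ.+ e * (8 * n ℕ.+ 16) , 8 * d ,
  trans (solve 2 (λ k d → con (+ 8) :* ((con (+ 1) :+ k :+ d) :- (con (+ 1) :+ k)) := con (+ 8) :* d) refl (+ k) (+ d))
    (sym (ℤ.pos-* 8 d)) ,
  (begin
    M n (suc k)
      ≡⟨ cong (λ p → + p ℤ.* (+ 8 ℤ.* + n ℤ.+ + 16) ℤ.- + 16) (sym 1+e≡2^k) ⟩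
    (+ 1 ℤ.+ + e) ℤ.* (+ 8 ℤ.* + n ℤ.+ + 16) ℤ.- + 16
      ≡⟨ solve 3 (λ e k d → let n′ = con (+ 1) :+ k :+ d in
           (con (+ 1) :+ e) :* (con (+ 8) :* n′ :+ con (+ 16)) :- con (+ 16)
           := con (+ 8) :+ (con (+ 8) :* k :+ e :* (con (+ 8) :* n′ :+ con (+ 16))) :+ con (+ 8) :* d) refl (+ e) (+ k) (+ d) ⟩
    + 8 ℤ.+ (+ 8 ℤ.* + k ℤ.+ + e ℤ.* (+ 8 ℤ.* + n ℤ.+ + 16)) ℤ.+ + 8 ℤ.* + d
      ≡⟨ cong₂ (λ p q → + 8 ℤ.+ p ℤ.+ q)
           (cong₂ ℤ._+_ (ℤ.pos-* 8 k)
             (trans (ℤ.pos-* e (8 * n ℕ.+ 16)) (cong (λ p → + e ℤ.* (p ℤ.+ + 16)) (ℤ.pos-* 8 n))))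
           (ℤ.pos-* 8 d) ⟨
    + 8 ℤ.+ + (8 * k ℕ.+ e * (8 * n ℕ.+ 16)) ℤ.+ + (8 * d) ∎)
  where open ≡-Reasoning

module Moves (n k : ℕ) {δ σ : ℕ} (s≡ : s n (suc k) ≡ + σ) (M≡ : M n (suc k) ≡ + 8 ℤ.+ + δ ℤ.+ + σ) where
  open Affine δ σ

  μ : Aff (M n (suc k))
  μ = cast (sym M≡) (const (+ 8) ⊕ δ̂ ⊕ σ̂)

  μ⁺ : Aff (M n (suc (suc k)))
  μ⁺ = cast (sym (M-step n k)) (double μ ⊕ const (+ 16))

  ς : Aff (s n (suc k))
  ς = cast (sym s≡) σ̂

  ς⁻ : Aff (s n k)
  ς⁻ = cast (sym (s-step n k)) (ς ⊕ const (+ 8))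

  g-aff : ∀ y → Aff (g n (suc k) (bits y))
  g-aff y =
      ⊝ ((double μ ⊕ const (+ 13)) ⊛ x i₁)
    ⊖ (μ ⊕ const (+ 5)) ⊛ x i₂
    ⊖ (μ ⊕ const (+ 3)) ⊛ x i₃
    ⊖ (μ ⊕ ς ⊕ const (+ 7)) ⊛ x i₄
    ⊖ const (bits y i₅)
    ⊖ (μ ⊕ const (+ 1)) ⊛ x i₆
    ⊖ (ς ⊕ const (+ 5)) ⊛ x iA
    ⊖ (ς ⊕ const (+ 3)) ⊛ x iB
    ⊕ (μ ⊕ const (+ 6)) ⊛ x i₁ ⊛ x i₂
    ⊕ (μ ⊕ const (+ 4)) ⊛ x i₂ ⊛ x i₃
    ⊕ (μ ⊕ const (+ 2)) ⊛ x i₃ ⊛ x i₆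
    ⊕ (μ ⊕ const (+ 6)) ⊛ x i₁ ⊛ x i₄
    ⊕ (μ ⊕ const (+ 4)) ⊛ x i₄ ⊛ x i₅
    ⊖ (μ ⊕ const (+ 2)) ⊛ x i₅ ⊛ x i₆
    ⊕ (ς ⊕ const (+ 4)) ⊛ x iA ⊛ x iB
    ⊖ const (+ 2) ⊛ x i₁ ⊛ x iB
    ⊕ (ς ⊕ const (+ 4)) ⊛ x i₂ ⊛ x iB
    ⊕ (ς ⊕ const (+ 2)) ⊛ x i₄ ⊛ x iA
    ⊕ (ς ⊕ const (+ 2)) ⊛ x i₄ ⊛ x iB
    ⊖ (ς ⊕ const (+ 4)) ⊛ x i₂ ⊛ x iA ⊛ x iB
    ⊖ (ς ⊕ const (+ 2)) ⊛ x i₄ ⊛ x iA ⊛ x iB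
    where
    x : Fin 8 → Bool
    x = lookup y

  couple-aff : ∀ ω u w → Aff (couple n k ω u w)
  couple-aff bottom         u w = μ ⊛ u ⊛ w
  couple-aff (output x₁ xB) u w = μ ⊛ u ⊛ x₁ ⊕ ς⁻ ⊛ xB ⊛ w

  energy-aff : ∀ ω u w y → Aff (energy n k ω u w y)
  energy-aff ω u w y =
    g-aff y ⊕ (μ⁺ ⊛ u ⊛ lookup y i₁ ⊕ ς ⊛ lookup y iB ⊛ w) ⊕ couple-aff ω (lookup y i₆) (lookup y iA)

  Resting : Output → (u w : Bool) → Block → Set
  Resting ω u w y = ∀ i → energy-aff ω u w (flip y i) ≼ energy-aff ω u w y

  resting? : ∀ ω u w y → Dec (Resting ω u w y)
  resting? ω u w y = Fin.all? λ i → energy-aff ω u w (flip y i) ≼? energy-aff ω u w y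

  resting⇒peak : ∀ ω u w y → Resting ω u w y → Peak (energy n k ω u w) y
  resting⇒peak ω u w y rest i = ≼⇒≤ {a = energy-aff ω u w (flip y i)} {energy-aff ω u w y} (rest i)

  -- x_6 = c guarantees that the blocks below, being in stable c, stay there.
  Path : Output → (c u w : Bool) → Block → List (Fin 8) → Set
  Path ω c u w y []       = ⊤
  Path ω c u w y (i ∷ is) =
    lookup y i₆ ≡ c × lookup y iB ≡ not u
    × energy-aff ω u w y ≺ energy-aff ω u w (flip y i)
    × (∀ j → j ≢ i → energy-aff ω u w (flip y j) ≼ energy-aff ω u w y)
    × Path ω c u w (flip y i) is

  path? : ∀ ω c u w y is → Dec (Path ω c u w y is)
  path? ω c u w y []       = yes tt
  path? ω c u w y (i ∷ is) =
    (lookup y i₆ Bool.≟ c) ×-dec (lookup y iB Bool.≟ not u)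
    ×-dec (energy-aff ω u w y ≺? energy-aff ω u w (flip y i))
    ×-dec (Fin.all? λ j → ¬? (j Fin.≟ i) →-dec (energy-aff ω u w (flip y j) ≼? energy-aff ω u w y))
    ×-dec path? ω c u w (flip y i) is

  Waits : (c u w : Bool) → Block → Set
  Waits c u w y = lookup y iB ≡ not u × Resting (output false (not c)) u w y × Resting (output true (not c)) u w y

  waits? : ∀ c u w y → Dec (Waits c u w y)
  waits? c u w y =
    (lookup y iB Bool.≟ not u) ×-dec resting? (output false (not c)) u w y ×-dec resting? (output true (not c)) u w y

  Cycle : (Bool → Output) → (u w : Bool) → Set
  Cycle κ u w =
    Path (κ false) false u w (settled (not u)) (moves₁ u)
    × Waits true u w (waiting₁ u)
    × Path (κ true) true u w (waiting₁ u) (moves₂ u)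
    × Waits false u w (waiting₂ u)
    × Path (κ false) false u w (waiting₂ u) moves₃

  cycle? : ∀ κ u w → Dec (Cycle κ u w)
  cycle? κ u w =
    path? (κ false) false u w (settled (not u)) (moves₁ u)
    ×-dec waits? true u w (waiting₁ u)
    ×-dec path? (κ true) true u w (waiting₁ u) (moves₂ u)
    ×-dec waits? false u w (waiting₂ u)
    ×-dec path? (κ false) false u w (waiting₂ u) moves₃

  cycle : ∀ j {u w} → Drive u w → Cycle (interface j) u w
  cycle j {u} {w} d = toWitness {a? = cycle? (interface j) u w} (ok j d)
    where
    ok : ∀ j {u w} → Drive u w → True (cycle? (interface j) u w)
    ok zero    up             = tt
    ok zero    (down {false}) = tt
    ok zero    (down {true})  = tt
    ok (suc _) up             = tt
    ok (suc _) (down {false}) = tt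
    ok (suc _) (down {true})  = tt

  settled-resting : ∀ j u w → Resting (interface j false) u w (settled u)
  settled-resting j u w = toWitness {a? = resting? (interface j false) u w (settled u)} (ok j u w)
    where
    ok : ∀ j u w → True (resting? (interface j false) u w (settled u))
    ok zero    false false = tt
    ok zero    false true  = tt
    ok zero    true  false = tt
    ok zero    true  true  = tt
    ok (suc _) false false = tt
    ok (suc _) false true  = tt
    ok (suc _) true  false = tt
    ok (suc _) true  true  = tt

stable : ∀ k → Bool → Assignment k
stable zero    c = []
stable (suc k) c = settled c ++ stable k false

out-stable : ∀ k c → out k (stable k c) ≡ interface k c
out-stable zero    c = refl
out-stable (suc k) c = refl

out-++ : ∀ k y (r : Assignment k) → out (suc k) (y ++ r) ≡ output (lookup y i₁) (lookup y iB)
out-++ k (_ ∷ _ ∷ _ ∷ _ ∷ _ ∷ _ ∷ _ ∷ _ ∷ []) r = refl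

-- x_(k,B) has not yet reached its final value c.
Pending : ∀ k → Bool → Assignment k → Set
Pending k c x = ∃ λ x₁ → out k x ≡ output x₁ (not c)

pending-++ : ∀ k {u y} (r : Assignment k) → lookup y iB ≡ not u → Pending (suc k) u (y ++ r)
pending-++ k {y = y} r eq = lookup y i₁ , trans (out-++ k y r) (cong (output (lookup y i₁)) eq)

stable-peak : ∀ n k → k ≤ n → ∀ c w → Peak (driven n k c w) (stable k c)
stable-peak n zero    _   c w ()
stable-peak n (suc k) k<n c w with δ , σ , s≡ , M≡ ← parameters n k k<n =
  peak-++ n k c w (settled c) (stable k false)
    (subst (λ ω → Peak (energy n k ω c w) (settled c)) (sym (out-stable k false))
      (resting⇒peak (interface k false) c w (settled c) (settled-resting k c w)))
    (stable-peak n k (ℕ.<⇒≤ k<n) false false)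
  where open Moves n k s≡ M≡

module _ (n k : ℕ) {δ σ : ℕ} (s≡ : s n (suc k) ≡ + σ) (M≡ : M n (suc k) ≡ + 8 ℤ.+ + δ ℤ.+ + σ)
  (k≤n : k ≤ n) (u w : Bool) where
  open Moves n k s≡ M≡
  open Affine δ σ

  Run⁺ : (x y : Assignment (suc k)) → ℕ → Set
  Run⁺ = Run (driven n (suc k) u w) (Pending (suc k) u)

  path-run : ∀ c y is → Path (interface k c) c u w y is →
    Run⁺ (y ++ stable k c) (List.foldl flip y is ++ stable k c) (List.length is)
  path-run c y []       _ = done
  path-run c y (i ∷ is) (y₆≡c , yB≡ , y≺ , others , path) =
    step (pending-++ k (stable k c) yB≡)
      (forced-++ˡ n k u w y (stable k c)
        (subst (λ ω → Forced (energy n k ω u w) y i) (sym (out-stable k c))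
          ( ≺⇒< {a = ε y} {ε (flip y i)} y≺
          , λ j j≢i → ≼⇒≤ {a = ε (flip y j)} {ε y} (others j j≢i)))
        (subst (λ v → Peak (driven n k v (lookup y iA)) (stable k c)) (sym y₆≡c) (stable-peak n k k≤n c (lookup y iA))))
      (flip-++ˡ y (stable k c) i)
      (path-run c (flip y i) is path)
    where ε = energy-aff (interface k c) u w

  wait-run : ∀ c y → Waits c u w y → ∀ {r r′ T} →
    Run (driven n k (lookup y i₆) (lookup y iA)) (Pending k c) r r′ T → Run⁺ (y ++ r) (y ++ r′) T
  wait-run c y waits done = done
  wait-run c y waits@(yB≡ , rest₀ , rest₁) (step {r} {i = j} (x₁ , out≡) forced refl run) =
    step (pending-++ k r yB≡)
      (forced-++ʳ n k u w y r
        (subst (λ ω → Peak (energy n k ω u w) y) (sym out≡) (resting⇒peak (output x₁ (not c)) u w y (rest x₁)))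
        forced)
      (flip-++ʳ y r j)
      (wait-run c y waits run)
    where
    rest : ∀ x₁ → Resting (output x₁ (not c)) u w y
    rest false = rest₀
    rest true  = rest₁

  cycle-run : ∀ {T} → Cycle (interface k) u w →
    Run (driven n k (lookup (waiting₁ u) i₆) (lookup (waiting₁ u) iA)) (Pending k true) (stable k false) (stable k true) T →
    Run (driven n k (lookup (waiting₂ u) i₆) (lookup (waiting₂ u) iA)) (Pending k false) (stable k true) (stable k false) T →
    Run⁺ (settled (not u) ++ stable k false) (List.foldl flip (waiting₂ u) moves₃ ++ stable k false)
      (List.length (moves₁ u) ℕ.+ (T ℕ.+ (List.length (moves₂ u) ℕ.+ (T ℕ.+ 2))))
  cycle-run (path₁ , waits₁ , path₂ , waits₂ , path₃) run₁ run₂ =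
    path-run false (settled (not u)) (moves₁ u) path₁
    ++ᴿ wait-run true (waiting₁ u) waits₁ run₁
    ++ᴿ path-run true (waiting₁ u) (moves₂ u) path₂
    ++ᴿ wait-run false (waiting₂ u) waits₂ run₂
    ++ᴿ path-run false (waiting₂ u) moves₃ path₃

duration : ℕ → ℕ
duration zero    = 0
duration (suc k) = 4 ℕ.+ (duration k ℕ.+ (4 ℕ.+ (duration k ℕ.+ 2)))

stable-run : ∀ n k → k ≤ n → ∀ {c w} → Drive c w →
  Run (driven n k c w) (Pending k c) (stable k (not c)) (stable k c) (duration k)
stable-run n zero    _   d = done
stable-run n (suc k) k<n d with δ , σ , s≡ , M≡ ← parameters n k k<n = go d
  where
  k≤n = ℕ.<⇒≤ k<n
  go : ∀ {c w} → Drive c w →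
    Run (driven n (suc k) c w) (Pending (suc k) c) (stable (suc k) (not c)) (stable (suc k) c) (duration (suc k))
  go up         = cycle-run n k s≡ M≡ k≤n true false (Moves.cycle n k s≡ M≡ k {true} {false} up)
    (stable-run n k k≤n up) (stable-run n k k≤n down)
  go (down {w}) = cycle-run n k s≡ M≡ k≤n false w (Moves.cycle n k s≡ M≡ k {false} {w} down)
    (stable-run n k k≤n up) (stable-run n k k≤n down)

duration≡ : ∀ m → duration m ≡ 10 * (2 ^ m ∸ 1)
duration≡ m = ℕ.+-cancelʳ-≡ 10 _ _ (trans (lemma m) (sym (begin
  10 * (2 ^ m ∸ 1) ℕ.+ 10 * 1 ≡⟨ ℕ.*-distribˡ-+ 10 (2 ^ m ∸ 1) 1 ⟨
  10 * (2 ^ m ∸ 1 ℕ.+ 1)      ≡⟨ cong (10 *_) (ℕ.m∸n+n≡m (ℕ.m^n>0 2 m)) ⟩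
  10 * 2 ^ m                  ∎)))
  where
  open ≡-Reasoning
  regroup : ∀ t → 4 ℕ.+ (t ℕ.+ (4 ℕ.+ (t ℕ.+ 2))) ℕ.+ 10 ≡ 2 * (t ℕ.+ 10)
  regroup = solve-∀
  swap : ∀ q → 2 * (10 * q) ≡ 10 * (2 * q)
  swap = solve-∀
  lemma : ∀ m → duration m ℕ.+ 10 ≡ 10 * 2 ^ m
  lemma zero    = refl
  lemma (suc m) = begin
    duration (suc m) ℕ.+ 10
      ≡⟨ regroup (duration m) ⟩
    2 * (duration m ℕ.+ 10) ≡⟨ cong (2 *_) (lemma m) ⟩
    2 * (10 * 2 ^ m)        ≡⟨ swap (2 ^ m) ⟩
    10 * 2 ^ suc m          ∎

stable-false : ∀ k → stable k false ≡ a k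
stable-false zero    = refl
stable-false (suc k) = cong (settled false ++_) (stable-false k)

stable-true : ∀ k → stable (suc k) true ≡ b (suc k)
stable-true k = cong (settled true ++_) (stable-false k)

opposite-inject₁ : ∀ {p} (j : Fin p) → opposite (inject₁ j) ≡ suc (opposite j)
opposite-inject₁ zero    = refl
opposite-inject₁ (suc j) = cong inject₁ (opposite-inject₁ j)

opposite-fromℕ : ∀ p → opposite (fromℕ p) ≡ zero
opposite-fromℕ zero    = refl
opposite-fromℕ (suc p) = cong inject₁ (opposite-fromℕ p)

var-inject₁ : ∀ p (y : Block) (r : Assignment p) (j : Fin p) → var {suc p} (y ++ r) (inject₁ j) ≡ var r j
var-inject₁ p y@(_ ∷ _ ∷ _ ∷ _ ∷ _ ∷ _ ∷ _ ∷ _ ∷ []) r j =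
  cong (λ o i → ⟦ lookup (y ++ r) (combine o i) ⟧) (opposite-inject₁ j)

var-top : ∀ p (x : Assignment (suc p)) → var x (fromℕ p) ≡ λ i → ⟦ lookup x (i ↑ˡ _) ⟧
var-top p x = cong (λ o i → ⟦ lookup x (combine o i) ⟧) (opposite-fromℕ p)

sum-last : ∀ {p} (t : Fin (suc p) → ℤ) (t′ : Fin p → ℤ) {e} → (∀ j → t (inject₁ j) ≡ t′ j) → t (fromℕ p) ≡ e →
  ∑[ j < suc p ] t j ≡ ∑[ j < p ] t′ j ℤ.+ e
sum-last t t′ init≡ last≡ = trans (sum-init-last t) (cong₂ ℤ._+_ (sum-cong-≗ init≡) last≡)

upperTerm lowerTerm : ℕ → ℕ → (v w : Fin 8 → ℤ) → ℤ
upperTerm n k v w = M n k ℤ.* v i₆ ℤ.* w i₁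
lowerTerm n k v w = s n k ℤ.* w iB ℤ.* v iA

blockAt : ∀ n p → Assignment (suc p) → Fin (suc p) → ℤ
blockAt n p x j = g n (level j) (var x j)

upperAt lowerAt : ∀ n p → Assignment (suc p) → Fin p → ℤ
upperAt n p x j = upperTerm n (level (suc j)) (var x (suc j)) (var x (inject₁ j))
lowerAt n p x j = lowerTerm n (level (inject₁ j)) (var x (suc j)) (var x (inject₁ j))

blocks upper lower : ∀ n p → Assignment (suc p) → ℤ
blocks n p x = ∑[ j < suc p ] blockAt n p x j
upper  n p x = ∑[ j < p ] upperAt n p x j
lower  n p x = ∑[ j < p ] lowerAt n p x j

cong₃ : ∀ {A B : Set} (h : ℕ → A → A → B) {k k′ v v′ w w′} → k ≡ k′ → v ≡ v′ → w ≡ w′ → h k v w ≡ h k′ v′ w′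
cong₃ h refl refl refl = refl

module _ (n p : ℕ) (y z : Block) (r : Assignment p) where
  private
    zr : Assignment (suc p)
    zr = z ++ r
    x : Assignment (suc (suc p))
    x = y ++ zr
    vy vz : Fin 8 → ℤ
    vy i = ⟦ lookup x (i ↑ˡ _) ⟧
    vz i = ⟦ lookup zr (i ↑ˡ _) ⟧

    var-second : var x (inject₁ (fromℕ p)) ≡ vz
    var-second = trans (var-inject₁ (suc p) y zr (fromℕ p)) (var-top p zr)

  blocks-++ : blocks n (suc p) x ≡ blocks n p zr ℤ.+ g n (suc (suc p)) vy
  blocks-++ = sum-last (blockAt n (suc p) x) (blockAt n p zr)
    (λ j → cong₂ (g n) (cong suc (Fin.toℕ-inject₁ j)) (var-inject₁ (suc p) y zr j))
    (cong₂ (g n) (cong suc (Fin.toℕ-fromℕ (suc p))) (var-top (suc p) x))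

  upper-++ : upper n (suc p) x ≡ upper n p zr ℤ.+ upperTerm n (suc (suc p)) vy vz
  upper-++ = sum-last (upperAt n (suc p) x) (upperAt n p zr)
    (λ j → cong₃ (upperTerm n) (cong (2 ℕ.+_) (Fin.toℕ-inject₁ j))
      (var-inject₁ (suc p) y zr (suc j)) (var-inject₁ (suc p) y zr (inject₁ j)))
    (cong₃ (upperTerm n) (cong (2 ℕ.+_) (Fin.toℕ-fromℕ p)) (var-top (suc p) x) var-second)

  lower-++ : lower n (suc p) x ≡ lower n p zr ℤ.+ lowerTerm n (suc p) vy vz
  lower-++ = sum-last (lowerAt n (suc p) x) (lowerAt n p zr)
    (λ j → cong₃ (lowerTerm n) (cong suc (Fin.toℕ-inject₁ (inject₁ j)))
      (var-inject₁ (suc p) y zr (suc j)) (var-inject₁ (suc p) y zr (inject₁ j)))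
    (cong₃ (lowerTerm n) (cong suc (trans (Fin.toℕ-inject₁ (fromℕ p)) (Fin.toℕ-fromℕ p))) (var-top (suc p) x) var-second)

M-one : ∀ n → M n 1 ≡ + 8 ℤ.* + n
M-one n = solve 1 (λ n → con (+ 1) :* (con (+ 8) :* n :+ con (+ 16)) :- con (+ 16) := con (+ 8) :* n) refl (+ n)

sums≡stack : ∀ n p (x : Assignment (suc p)) →
  blocks n p x ℤ.+ upper n p x ℤ.+ lower n p x ℤ.+ + 8 ℤ.* + n ℤ.* var {suc p} x zero i₆ ℤ.* var {suc p} x zero iA
  ≡ stack n (suc p) x
sums≡stack n zero (x₁ ∷ x₂ ∷ x₃ ∷ x₄ ∷ x₅ ∷ x₆ ∷ xA ∷ xB ∷ []) = trans
  (solve 2 (λ G C → G :+ con (+ 0) :+ con (+ 0) :+ con (+ 0) :+ C := G :+ C :+ con (+ 0)) refl G (+ 8 ℤ.* + n ℤ.* ⟦ x₆ ⟧ ℤ.* ⟦ xA ⟧))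
  (cong (λ c → G ℤ.+ c ℤ.* ⟦ x₆ ⟧ ℤ.* ⟦ xA ⟧ ℤ.+ + 0) (sym (M-one n)))
  where
  G = g n 1 (bits (x₁ ∷ x₂ ∷ x₃ ∷ x₄ ∷ x₅ ∷ x₆ ∷ xA ∷ xB ∷ []))
sums≡stack n (suc p)
  (x₁ ∷ x₂ ∷ x₃ ∷ x₄ ∷ x₅ ∷ x₆ ∷ xA ∷ xB ∷ z₁ ∷ z₂ ∷ z₃ ∷ z₄ ∷ z₅ ∷ z₆ ∷ zA ∷ zB ∷ r) = begin
  blocks n (suc p) x ℤ.+ upper n (suc p) x ℤ.+ lower n (suc p) x ℤ.+ first (var {suc (suc p)} x zero)
    ≡⟨ cong₂ ℤ._+_ (cong₂ ℤ._+_ (cong₂ ℤ._+_ (blocks-++ n p y z r) (upper-++ n p y z r)) (lower-++ n p y z r))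
         (cong first (var-inject₁ (suc p) y (z ++ r) zero)) ⟩
  (blocks n p zr ℤ.+ G) ℤ.+ (upper n p zr ℤ.+ U) ℤ.+ (lower n p zr ℤ.+ L) ℤ.+ first (var {suc p} zr zero)
    ≡⟨ solve 7 (λ b u l f g u′ l′ → (b :+ g) :+ (u :+ u′) :+ (l :+ l′) :+ f := g :+ (u′ :+ l′) :+ (b :+ u :+ l :+ f)) refl
         (blocks n p zr) (upper n p zr) (lower n p zr) (first (var {suc p} zr zero)) G U L ⟩
  G ℤ.+ (U ℤ.+ L) ℤ.+ (blocks n p zr ℤ.+ upper n p zr ℤ.+ lower n p zr ℤ.+ first (var {suc p} zr zero))
    ≡⟨ cong (λ t → G ℤ.+ (U ℤ.+ L) ℤ.+ t) (sums≡stack n p zr) ⟩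
  stack n (suc (suc p)) x ∎
  where
  open ≡-Reasoning
  y z : Block
  y = x₁ ∷ x₂ ∷ x₃ ∷ x₄ ∷ x₅ ∷ x₆ ∷ xA ∷ xB ∷ []
  z = z₁ ∷ z₂ ∷ z₃ ∷ z₄ ∷ z₅ ∷ z₆ ∷ zA ∷ zB ∷ []
  zr : Assignment (suc p)
  zr = z ++ r
  x : Assignment (suc (suc p))
  x = y ++ zr
  first : (Fin 8 → ℤ) → ℤ
  first v = + 8 ℤ.* + n ℤ.* v i₆ ℤ.* v iA
  G = g n (suc (suc p)) (bits y)
  U = M n (suc (suc p)) ℤ.* ⟦ x₆ ⟧ ℤ.* ⟦ z₁ ⟧
  L = s n (suc p) ℤ.* ⟦ zB ⟧ ℤ.* ⟦ xA ⟧

driven≡fitness : ∀ n p P x → driven n (suc p) P false x ≡ fitness n (suc p) P x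
driven≡fitness n p P x@(x₁ ∷ x₂ ∷ x₃ ∷ x₄ ∷ x₅ ∷ x₆ ∷ xA ∷ xB ∷ r) =
  cong₂ ℤ._+_ (sym (sums≡stack n p x)) (begin
    M n (suc (suc p)) ℤ.* ⟦ P ⟧ ℤ.* ⟦ x₁ ⟧ ℤ.+ s n (suc p) ℤ.* ⟦ xB ⟧ ℤ.* + 0
      ≡⟨ cong (λ c → c ℤ.* ⟦ P ⟧ ℤ.* ⟦ x₁ ⟧ ℤ.+ s n (suc p) ℤ.* ⟦ xB ⟧ ℤ.* + 0) (M-step n p) ⟩
    (+ 2 ℤ.* M n (suc p) ℤ.+ + 16) ℤ.* ⟦ P ⟧ ℤ.* ⟦ x₁ ⟧ ℤ.+ s n (suc p) ℤ.* ⟦ xB ⟧ ℤ.* + 0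
      ≡⟨ solve 5 (λ c P x s q → c :* P :* x :+ s :* q :* con (+ 0) := P :* c :* x) refl
           (+ 2 ℤ.* M n (suc p) ℤ.+ + 16) ⟦ P ⟧ ⟦ x₁ ⟧ (s n (suc p)) ⟦ xB ⟧ ⟩
    ⟦ P ⟧ ℤ.* (+ 2 ℤ.* M n (suc p) ℤ.+ + 16) ℤ.* ⟦ x₁ ⟧
      ≡⟨ cong (λ v → ⟦ P ⟧ ℤ.* (+ 2 ℤ.* M n (suc p) ℤ.+ + 16) ℤ.* v i₁) (var-top p x) ⟨
    ⟦ P ⟧ ℤ.* (+ 2 ℤ.* M n (suc p) ℤ.+ + 16) ℤ.* var x (fromℕ p) i₁ ∎)
  where open ≡-Reasoning

fitness-ascent : ∀ n p → suc p ≤ n → ∀ P → Drive P false →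
  Landscape.ExactlyOneAscent (fitness n (suc p) P) (stable (suc p) (not P)) (stable (suc p) P) (duration (suc p))
fitness-ascent n p p<n P d = run⇒exactlyOneAscent
  (Run-cong (driven≡fitness n p P) (stable-run n (suc p) p<n d))
  (Peak-cong (driven≡fitness n p P) {stable (suc p) P} (stable-peak n (suc p) p<n P false))

theorem4p1 : (n m : ℕ) .{{_ : NonZero n}} .{{_ : NonZero m}} → m ≤ n →
    Landscape.ExactlyOneAscent (fitness n m true) (a m) (b m) (10 * (2 ^ m ∸ 1))
    × Landscape.ExactlyOneAscent (fitness n m false) (b m) (a m) (10 * (2 ^ m ∸ 1))
theorem4p1 n zero    _   = contradiction refl (ℕ.≢-nonZero⁻¹ 0)
theorem4p1 n (suc p) p<n =
  subst (Ascends true (a (suc p)) (b (suc p))) (duration≡ (suc p))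
    (subst₂ (λ x y → Ascends true x y (duration (suc p))) (stable-false (suc p)) (stable-true p)
      (fitness-ascent n p p<n true up)) ,
  subst (Ascends false (b (suc p)) (a (suc p))) (duration≡ (suc p))
    (subst₂ (λ x y → Ascends false x y (duration (suc p))) (stable-true p) (stable-false (suc p))
      (fitness-ascent n p p<n false down))
  where
  Ascends : Bool → Assignment (suc p) → Assignment (suc p) → ℕ → Set
  Ascends P = Landscape.ExactlyOneAscent (fitness n (suc p) P)
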